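{- Let $m,n\geq 2$ be natural numbers with $\omega(m)=\omega(n)=r$, with prime factorizations $n=p_1^{\alpha_1}p_2^{\alpha_2}\cdots p_r^{\alpha_r}$ and $m=q_1^{\beta_1}q_2^{\beta_2}\cdots q_r^{\beta_r}$, where $p_1,\dots,p_r$ are distinct primes, $q_1,\dots,q_r$ are distinct primes, and all $\alpha_i,\beta_i$ are positive integers. Then $$D(n||m)=H(m)-H(n)+\sum_{i=1}^{r}\left(\frac{\beta_i}{\Omega(m)}-\frac{\alpha_i}{\Omega(n)}\right)\log \beta_i .$$
   Context: $\log$ is the natural logarithm. For $n=p_1^{\alpha_1}\cdots p_r^{\alpha_r}\geq 2$ (distinct primes $p_i$, exponents $\alpha_i\geq 1$), $\Omega(n)=\alpha_1+\dots+\alpha_r$, $\omega(n)=r$ is the number of distinct prime factors, and the entropy of $n$ is $$H(n)=-\sum_{i=1}^r\frac{\alpha_i}{\Omega(n)}\log\frac{\alpha_i}{\Omega(n)}.$$ For $n=p_1^{\alpha_1}\cdots p_r^{\alpha_r}$ and $m=q_1^{\beta_1}\cdots q_r^{\beta_r}$ with the same number $r$ of distinct prime factors (with the given orderings of the factors), the Kullback--Leibler divergence is $$D(n||m)=-\sum_{i=1}^r\frac{\alpha_i}{\Omega(n)}\log\frac{\beta_i/\Omega(m)}{\alpha_i/\Omega(n)}=\log\frac{\Omega(m)}{\Omega(n)}-\frac{1}{\Omega(n)}\sum_{i=1}^r\alpha_i\log\frac{\beta_i}{\alpha_i}.$$ -}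

module Defs where

open import Algebra.Bundles.Raw using (RawMonoid)
import Algebra.Definitions.RawMonoid as RawMonoidDefinitions
open import Data.Fin.Base using (Fin; zero; suc)
open import Data.Integer.Base as ℤ using (+_; -[1+_])
import Data.Integer.Properties as ℤₚ
open import Data.List.Base using (List; []; _∷_; length; lookup; filter; deduplicate)
open import Data.List.Membership.Propositional.Properties using (∈-lookup; ∈-deduplicate⁻)
open import Data.List.Properties using (filter-some)
open import Data.Nat.Base as ℕ using (ℕ; zero; suc; NonTrivial)
import Data.Nat.Coprimality as Coprimality
open import Data.Nat.Primality using (Prime)
open import Data.Nat.Primality.Factorisation using (PrimeFactorisation; factors; factorise)
import Data.Nat.Properties as ℕₚ
open import Data.Product.Base using (∃-syntax; _,_; proj₁; proj₂)
open import Data.Rational.Base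
  using (ℚ; mkℚ; 0ℚ; 1ℚ; ½; _/_; _+_; _*_; _-_; -_; _÷_; 1/_; ∣_∣; _≤_; _<_; *≤*;
         Positive; NonZero; nonNegative)
import Data.Rational.Properties as ℚₚ
open import Data.Rational.Solver using (module +-*-Solver)
open import Data.Sum.Base using (inj₁; inj₂)
open import Function.Definitions using (Injective)
open import Level using (0ℓ)
open import Relation.Nullary.Negation.Core using (contradiction)
open import Relation.Binary.PropositionalEquality
  using (_≡_; refl; sym; trans; cong; cong₂; subst; module ≡-Reasoning)

open +-*-Solver using (solve; con; _:=_; _:+_; _:*_; _:-_; :-_)

------------------------------------------------------------------------
-- Auxiliary facts about ℚ

∣p∣≤ : ∀ {p δ} → p ≤ δ → - p ≤ δ → ∣ p ∣ ≤ δ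
∣p∣≤ {p} p≤δ -p≤δ with ℚₚ.∣p∣≡p∨∣p∣≡-p p
... | inj₁ eq = ℚₚ.≤-trans (ℚₚ.≤-reflexive eq) p≤δ
... | inj₂ eq = ℚₚ.≤-trans (ℚₚ.≤-reflexive eq) -p≤δ

p≤p+q : ∀ {p q} → 0ℚ ≤ q → p ≤ p + q
p≤p+q {p} {q} 0≤q = begin
  p       ≡⟨ ℚₚ.+-identityʳ p ⟨
  p + 0ℚ  ≤⟨ ℚₚ.+-monoʳ-≤ p 0≤q ⟩
  p + q   ∎
  where open ℚₚ.≤-Reasoning

-- Two points of the interval [l , l + δ] are at distance at most δ.
∣u-v∣≤ : ∀ {l u v δ} → l ≤ u → u ≤ l + δ → l ≤ v → v ≤ l + δ → ∣ u - v ∣ ≤ δ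
∣u-v∣≤ {l} {u} {v} {δ} l≤u u≤ l≤v v≤ = ∣p∣≤ (bound u≤ l≤v) (begin
    - (u - v)  ≡⟨ solve 2 (λ u v → :- (u :- v) := v :- u) refl u v ⟩
    v - u      ≤⟨ bound v≤ l≤u ⟩
    δ          ∎)
  where
  open ℚₚ.≤-Reasoning
  bound : ∀ {u v} → u ≤ l + δ → l ≤ v → u - v ≤ δ
  bound {u} {v} u≤ l≤v = begin
    u - v        ≤⟨ ℚₚ.+-mono-≤ u≤ (ℚₚ.neg-antimono-≤ l≤v) ⟩
    (l + δ) - l  ≡⟨ solve 2 (λ l δ → (l :+ δ) :- l := δ) refl l δ ⟩
    δ            ∎

0≤p*p : ∀ p → 0ℚ ≤ p * p
0≤p*p p@(mkℚ (+ _) _ _)    = ℚₚ.nonNegative⁻¹ (p * p) {{ℚₚ.nonNeg*nonNeg⇒nonNeg p p}}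
0≤p*p p@(mkℚ -[1+ _ ] _ _) =
  ℚₚ.nonNegative⁻¹ (p * p) {{ℚₚ.pos⇒nonNeg (p * p) {{ℚₚ.neg*neg⇒pos p p}}}}

pos⇒0≤ : ∀ p → .{{_ : Positive p}} → 0ℚ ≤ p
pos⇒0≤ p = ℚₚ.<⇒≤ (ℚₚ.positive⁻¹ p)

0≤p*q : ∀ {p q} → 0ℚ ≤ p → 0ℚ ≤ q → 0ℚ ≤ p * q
0≤p*q {p} {q} 0≤p 0≤q = ℚₚ.nonNegative⁻¹ (p * q)
  {{ℚₚ.nonNeg*nonNeg⇒nonNeg p {{nonNegative 0≤p}} q {{nonNegative 0≤q}}}}

recip : ∀ a → .{{_ : Positive a}} → ℚ
recip a = (1/ a) {{ℚₚ.pos⇒nonZero a}}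

recip-inverse : ∀ a → .{{_ : Positive a}} → a * recip a ≡ 1ℚ
recip-inverse a = ℚₚ.*-inverseʳ a {{ℚₚ.pos⇒nonZero a}}

recip-pos : ∀ a → .{{_ : Positive a}} → Positive (recip a)
recip-pos a = ℚₚ.1/pos⇒pos a

recip-cancel : ∀ a ε → .{{_ : Positive a}} → a * (recip a * ε) ≡ ε
recip-cancel a ε = begin
  a * (recip a * ε)  ≡⟨ ℚₚ.*-assoc a (recip a) ε ⟨
  a * recip a * ε    ≡⟨ cong (_* ε) (recip-inverse a) ⟩
  1ℚ * ε             ≡⟨ ℚₚ.*-identityˡ ε ⟩
  ε                  ∎
  where open ≡-Reasoning

½^_ : ℕ → ℚ
½^ zero  = 1ℚ
½^ suc n = ½ * ½^ n

½^-pos : ∀ n → Positive (½^ n)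
½^-pos zero    = _
½^-pos (suc n) = ℚₚ.pos*pos⇒pos ½ (½^ n) {{½^-pos n}}

½^≤1 : ∀ n → ½^ n ≤ 1ℚ
½^≤1 zero    = ℚₚ.≤-refl
½^≤1 (suc n) = begin
  ½ * ½^ n  ≤⟨ ℚₚ.*-monoˡ-≤-nonNeg ½ (½^≤1 n) ⟩
  ½ * 1ℚ    ≤⟨ *≤* (ℤ.+≤+ (ℕ.s≤s ℕ.z≤n)) ⟩
  1ℚ        ∎
  where open ℚₚ.≤-Reasoning

ι : ℕ → ℚ
ι zero    = 0ℚ
ι (suc n) = 1ℚ + ι n

ι≡mkℚ : ∀ n → ι n ≡ mkℚ (+ n) 0 (Coprimality.sym (Coprimality.1-coprimeTo n))
ι≡mkℚ zero    = refl
ι≡mkℚ (suc n) = trans (cong (λ x → 1ℚ + x) (ι≡mkℚ n))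
  (trans (ℚₚ./-cong {q₁ = 1} {q₂ = 1} (cong (λ i → + 1 ℤ.+ i) (ℤₚ.*-identityʳ (+ n))) refl)
         (ℚₚ.normalize-coprime (Coprimality.sym (Coprimality.1-coprimeTo (suc n)))))

≤ι : ∀ p → p ≤ ι ℤ.∣ ℚ.numerator p ∣
≤ι p@(mkℚ i d-1 c) = subst (p ≤_) (sym (ι≡mkℚ ℤ.∣ i ∣)) (*≤* (begin
  i ℤ.* + 1                    ≡⟨ ℤₚ.*-identityʳ i ⟩
  i                            ≤⟨ i≤∣i∣ i ⟩
  + ℤ.∣ i ∣                    ≤⟨ ℤ.+≤+ (ℕₚ.m≤m*n ℤ.∣ i ∣ (suc d-1)) ⟩
  + (ℤ.∣ i ∣ ℕ.* suc d-1)      ≡⟨ ℤₚ.pos-* ℤ.∣ i ∣ (suc d-1) ⟩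
  + ℤ.∣ i ∣ ℤ.* + suc d-1      ∎))
  where
  open ℤₚ.≤-Reasoning
  i≤∣i∣ : ∀ i → i ℤ.≤ + ℤ.∣ i ∣
  i≤∣i∣ (+ _)    = ℤₚ.≤-refl
  i≤∣i∣ -[1+ _ ] = ℤ.-≤+

ι*½^<1 : ∀ n → ι n * ½^ n < 1ℚ
ι*½^<1 zero    = ℚₚ.positive⁻¹ 1ℚ
ι*½^<1 (suc n) = begin-strict
  (1ℚ + ι n) * (½ * ½^ n)    ≡⟨ solve 2 (λ i h → (con 1ℚ :+ i) :* (con ½ :* h)
                                  := con ½ :* (h :+ i :* h)) refl (ι n) (½^ n) ⟩
  ½ * (½^ n + ι n * ½^ n)    <⟨ ℚₚ.*-monoʳ-<-pos ½ (ℚₚ.+-mono-≤-< (½^≤1 n) (ι*½^<1 n)) ⟩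
  ½ * (1ℚ + 1ℚ)              ≡⟨⟩
  1ℚ                         ∎
  where open ℚₚ.≤-Reasoning

archimedean : ∀ c ε → .{{_ : Positive ε}} → ∃[ N ] c * ½^ N < ε
archimedean c ε = N , (begin-strict
  c * ½^ N              ≡⟨ recip-cancel ε (c * ½^ N) ⟨
  ε * (recip ε * (c * ½^ N))
    ≡⟨ cong (ε *_) (solve 3 (λ i c h → i :* (c :* h) := c :* i :* h) refl (recip ε) c (½^ N)) ⟩
  ε * (r * ½^ N)        ≤⟨ ℚₚ.*-monoˡ-≤-nonNeg ε {{ℚₚ.pos⇒nonNeg ε}}
                             (ℚₚ.*-monoʳ-≤-nonNeg (½^ N) {{ℚₚ.pos⇒nonNeg (½^ N) {{½^-pos N}}}} (≤ι r)) ⟩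
  ε * (ι N * ½^ N)      <⟨ ℚₚ.*-monoʳ-<-pos ε (ι*½^<1 N) ⟩
  ε * 1ℚ                ≡⟨ ℚₚ.*-identityʳ ε ⟩
  ε                     ∎)
  where
  open ℚₚ.≤-Reasoning
  r = c * recip ε
  N = ℤ.∣ ℚ.numerator r ∣

------------------------------------------------------------------------
-- Real numbers: Cauchy sequences of rationals

record ℝ : Set where
  field
    seq    : ℕ → ℚ
    cauchy : ∀ ε → .{{_ : Positive ε}} →
             ∃[ N ] ∀ m n → N ℕ.≤ m → N ℕ.≤ n → ∣ seq m - seq n ∣ < ε

open ℝ public

infix  4 _≃_
infix  8 ⁻_
infixl 7 _·_
infixl 6 _⊕_ _⊖_

_≃_ : ℝ → ℝ → Set
x ≃ y = ∀ ε → .{{_ : Positive ε}} → ∃[ N ] ∀ n → N ℕ.≤ n → ∣ seq x n - seq y n ∣ < ε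

0ℝ : ℝ
0ℝ = record { seq = λ _ → 0ℚ ; cauchy = λ ε → 0 , λ _ _ _ _ → ℚₚ.positive⁻¹ ε }

_⊕_ : ℝ → ℝ → ℝ
x ⊕ y = record { seq = λ n → seq x n + seq y n ; cauchy = cauchy-⊕ }
  where
  open ℚₚ.≤-Reasoning
  cauchy-⊕ : ∀ ε → .{{_ : Positive ε}} → ∃[ N ] ∀ m n → N ℕ.≤ m → N ℕ.≤ n →
             ∣ (seq x m + seq y m) - (seq x n + seq y n) ∣ < ε
  cauchy-⊕ ε with cauchy x (½ * ε) {{ℚₚ.pos*pos⇒pos ½ ε}}
                | cauchy y (½ * ε) {{ℚₚ.pos*pos⇒pos ½ ε}}
  ... | Nx , closeˣ | Ny , closeʸ = Nx ℕ.⊔ Ny , λ m n N≤m N≤n → begin-strict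
    ∣ (seq x m + seq y m) - (seq x n + seq y n) ∣
      ≡⟨ cong ∣_∣ (solve 4 (λ a b c d → (a :+ b) :- (c :+ d) := (a :- c) :+ (b :- d)) refl
           (seq x m) (seq y m) (seq x n) (seq y n)) ⟩
    ∣ (seq x m - seq x n) + (seq y m - seq y n) ∣
      ≤⟨ ℚₚ.∣p+q∣≤∣p∣+∣q∣ (seq x m - seq x n) (seq y m - seq y n) ⟩
    ∣ seq x m - seq x n ∣ + ∣ seq y m - seq y n ∣
      <⟨ ℚₚ.+-mono-< (closeˣ m n (ℕₚ.m⊔n≤o⇒m≤o Nx Ny N≤m) (ℕₚ.m⊔n≤o⇒m≤o Nx Ny N≤n))
                     (closeʸ m n (ℕₚ.m⊔n≤o⇒n≤o Nx Ny N≤m) (ℕₚ.m⊔n≤o⇒n≤o Nx Ny N≤n)) ⟩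
    ½ * ε + ½ * ε
      ≡⟨ solve 1 (λ ε → con ½ :* ε :+ con ½ :* ε := ε) refl ε ⟩
    ε ∎

∣qu-qv∣< : ∀ q s u v ε → .{{_ : Positive s}} → ∣ q ∣ ≤ s → ∣ u - v ∣ < recip s * ε →
          ∣ q * u - q * v ∣ < ε
∣qu-qv∣< q s u v ε ∣q∣≤s u~v = begin-strict
  ∣ q * u - q * v ∣    ≡⟨ cong ∣_∣ (solve 3 (λ q u v → q :* u :- q :* v := q :* (u :- v)) refl q u v) ⟩
  ∣ q * (u - v) ∣      ≡⟨ ℚₚ.∣p*q∣≡∣p∣*∣q∣ q (u - v) ⟩
  ∣ q ∣ * ∣ u - v ∣    ≤⟨ ℚₚ.*-monoʳ-≤-nonNeg ∣ u - v ∣ {{ℚₚ.∣-∣-nonNeg (u - v)}} ∣q∣≤s ⟩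
  s * ∣ u - v ∣        <⟨ ℚₚ.*-monoʳ-<-pos s u~v ⟩
  s * (recip s * ε)    ≡⟨ recip-cancel s ε ⟩
  ε                    ∎
  where open ℚₚ.≤-Reasoning

_·_ : ℚ → ℝ → ℝ
q · x = record { seq = λ n → q * seq x n ; cauchy = cauchy-· }
  where
  s = 1ℚ + ∣ q ∣
  instance
    s>0 : Positive s
    s>0 = ℚₚ.pos+nonNeg⇒pos 1ℚ ∣ q ∣ {{ℚₚ.∣-∣-nonNeg q}}
  ∣q∣≤s : ∣ q ∣ ≤ s
  ∣q∣≤s = subst (∣ q ∣ ≤_) (ℚₚ.+-comm ∣ q ∣ 1ℚ) (p≤p+q (pos⇒0≤ 1ℚ))
  cauchy-· : ∀ ε → .{{_ : Positive ε}} → ∃[ N ] ∀ m n → N ℕ.≤ m → N ℕ.≤ n →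
             ∣ q * seq x m - q * seq x n ∣ < ε
  cauchy-· ε = proj₁ close , λ m n N≤m N≤n →
    ∣qu-qv∣< q s (seq x m) (seq x n) ε ∣q∣≤s (proj₂ close m n N≤m N≤n)
    where
    close = cauchy x (recip s * ε) {{ℚₚ.pos*pos⇒pos (recip s) {{recip-pos s}} ε}}

⁻_ : ℝ → ℝ
⁻ x = (- 1ℚ) · x

_⊖_ : ℝ → ℝ → ℝ
x ⊖ y = x ⊕ ⁻ y

⊕-0-rawMonoid : RawMonoid 0ℓ 0ℓ
⊕-0-rawMonoid = record { Carrier = ℝ ; _≈_ = _≃_ ; _∙_ = _⊕_ ; ε = 0ℝ }

open RawMonoidDefinitions ⊕-0-rawMonoid public using () renaming (sum to ∑ℝ)
open RawMonoidDefinitions ℕ.+-0-rawMonoid public using () renaming (sum to ∑ℕ)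
open RawMonoidDefinitions ℕ.*-1-rawMonoid public using () renaming (sum to ∏ℕ)

------------------------------------------------------------------------
-- The natural logarithm

midpoint : ℚ → ℚ → ℚ
midpoint a b = ½ * (a + b)

midpoint-pos : ∀ a b → .{{_ : Positive a}} → .{{_ : Positive b}} → Positive (midpoint a b)
midpoint-pos a b = ℚₚ.pos*pos⇒pos ½ (a + b) {{ℚₚ.pos+pos⇒pos a b}}

-- riemann n a b is the right-endpoint Riemann sum of ∫ₐᵇ dt/t over the partition
-- of the interval between a and b into 2ⁿ equal pieces (b < a is allowed, and gives
-- the oriented integral).
riemann : ℕ → ∀ a b → .{{_ : Positive a}} → .{{_ : Positive b}} → ℚ
riemann zero    a b = (b - a) * recip b
riemann (suc n) a b = riemann n a m + riemann n m b
  where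
  m = midpoint a b
  instance
    m>0 : Positive m
    m>0 = midpoint-pos a b

-- The difference between the left- and right-endpoint sums with a single piece.
gap : ∀ a b → .{{_ : Positive a}} → .{{_ : Positive b}} → ℚ
gap a b = (b - a) * (recip a - recip b)

recip-diff : ∀ a b → .{{_ : Positive a}} → .{{_ : Positive b}} →
             recip a - recip b ≡ (b - a) * (recip a * recip b)
recip-diff a b = begin
  recip a - recip b
    ≡⟨ solve 2 (λ x y → x :- y := x :* con 1ℚ :- con 1ℚ :* y) refl (recip a) (recip b) ⟩
  recip a * 1ℚ - 1ℚ * recip b
    ≡⟨ cong₂ (λ u v → recip a * u - v * recip b) (recip-inverse b) (recip-inverse a) ⟨
  recip a * (b * recip b) - (a * recip a) * recip b
    ≡⟨ solve 4 (λ a b x y → x :* (b :* y) :- (a :* x) :* y := (b :- a) :* (x :* y)) refl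
         a b (recip a) (recip b) ⟩
  (b - a) * (recip a * recip b) ∎
  where open ≡-Reasoning

gap≥0 : ∀ a b → .{{_ : Positive a}} → .{{_ : Positive b}} → 0ℚ ≤ gap a b
gap≥0 a b = subst (0ℚ ≤_) (sym eq)
  (0≤p*q (0≤p*p (b - a))
         (0≤p*q (pos⇒0≤ (recip a) {{recip-pos a}}) (pos⇒0≤ (recip b) {{recip-pos b}})))
  where
  open ≡-Reasoning
  eq : gap a b ≡ ((b - a) * (b - a)) * (recip a * recip b)
  eq = begin
    (b - a) * (recip a - recip b)               ≡⟨ cong ((b - a) *_) (recip-diff a b) ⟩
    (b - a) * ((b - a) * (recip a * recip b))   ≡⟨ ℚₚ.*-assoc (b - a) (b - a) _ ⟨
    ((b - a) * (b - a)) * (recip a * recip b)   ∎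

-- Bisecting increases the right-endpoint sum and halves the gap.
module _ (a b : ℚ) .{{_ : Positive a}} .{{_ : Positive b}} where
  private
    m = midpoint a b
    instance
      m>0 : Positive m
      m>0 = midpoint-pos a b

  riemann₁ : riemann 1 a b ≡ riemann 0 a b + gap m b
  riemann₁ = solve 4 (λ a b x y → let m = con ½ :* (a :+ b) in
      (m :- a) :* x :+ (b :- m) :* y := (b :- a) :* y :+ (b :- m) :* (x :- y))
    refl a b (recip m) (recip b)

  riemann₁′ : riemann 1 a b + gap a m ≡ riemann 0 a b + gap a b * ½
  riemann₁′ = solve 5 (λ a b x y z → let m = con ½ :* (a :+ b) in
      ((m :- a) :* x :+ (b :- m) :* y) :+ (m :- a) :* (z :- x)
      := (b :- a) :* y :+ (b :- a) :* (z :- y) :* con ½)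
    refl a b (recip m) (recip b) (recip a)

  gap-bisect : gap a m + gap m b ≡ gap a b * ½
  gap-bisect = solve 5 (λ a b x y z → let m = con ½ :* (a :+ b) in
      (m :- a) :* (x :- z) :+ (b :- m) :* (z :- y) := (b :- a) :* (x :- y) :* con ½)
    refl a b (recip a) (recip b) (recip m)

riemann-mono : ∀ n a b → .{{_ : Positive a}} → .{{_ : Positive b}} →
               riemann n a b ≤ riemann (suc n) a b
riemann-mono zero    a b =
  subst (riemann 0 a b ≤_) (sym (riemann₁ a b)) (p≤p+q (gap≥0 m b))
  where
  m = midpoint a b
  instance
    m>0 : Positive m
    m>0 = midpoint-pos a b
riemann-mono (suc n) a b = ℚₚ.+-mono-≤ (riemann-mono n a m) (riemann-mono n m b)
  where
  m = midpoint a b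
  instance
    m>0 : Positive m
    m>0 = midpoint-pos a b

riemann-step : ∀ n a b → .{{_ : Positive a}} → .{{_ : Positive b}} →
               riemann (suc n) a b ≤ riemann n a b + gap a b * ½^ (suc n)
riemann-step zero    a b =
  subst (riemann 1 a b ≤_) (riemann₁′ a b) (p≤p+q (gap≥0 a m))
  where
  m = midpoint a b
  instance
    m>0 : Positive m
    m>0 = midpoint-pos a b
riemann-step (suc n) a b = begin
  riemann (suc n) a m + riemann (suc n) m b
    ≤⟨ ℚₚ.+-mono-≤ (riemann-step n a m) (riemann-step n m b) ⟩
  (riemann n a m + gap a m * h) + (riemann n m b + gap m b * h)
    ≡⟨ solve 5 (λ r s x y h → (r :+ x :* h) :+ (s :+ y :* h) := (r :+ s) :+ (x :+ y) :* h) refl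
         (riemann n a m) (riemann n m b) (gap a m) (gap m b) h ⟩
  riemann (suc n) a b + (gap a m + gap m b) * h
    ≡⟨ cong (λ g → riemann (suc n) a b + g * h) (gap-bisect a b) ⟩
  riemann (suc n) a b + (gap a b * ½) * h
    ≡⟨ cong (λ g → riemann (suc n) a b + g) (ℚₚ.*-assoc (gap a b) ½ h) ⟩
  riemann (suc n) a b + gap a b * (½ * h) ∎
  where
  open ℚₚ.≤-Reasoning
  h = ½^ (suc n)
  m = midpoint a b
  instance
    m>0 : Positive m
    m>0 = midpoint-pos a b

riemann-≤ : ∀ {m n} a b → .{{_ : Positive a}} → .{{_ : Positive b}} → m ℕ.≤ n →
            riemann m a b ≤ riemann n a b
riemann-≤ {m} a b m≤n = go (ℕₚ.≤⇒≤′ m≤n)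
  where
  go : ∀ {n} → m ℕ.≤′ n → riemann m a b ≤ riemann n a b
  go (ℕ.≤′-reflexive refl)    = ℚₚ.≤-refl
  go (ℕ.≤′-step {n = n} m≤′n) = ℚₚ.≤-trans (go m≤′n) (riemann-mono n a b)

upper : ℕ → ∀ a b → .{{_ : Positive a}} → .{{_ : Positive b}} → ℚ
upper n a b = riemann n a b + gap a b * ½^ n

upper-≥ : ∀ {m n} a b → .{{_ : Positive a}} → .{{_ : Positive b}} → m ℕ.≤ n →
          upper n a b ≤ upper m a b
upper-≥ {m} a b m≤n = go (ℕₚ.≤⇒≤′ m≤n)
  where
  open ℚₚ.≤-Reasoning
  go : ∀ {n} → m ℕ.≤′ n → upper n a b ≤ upper m a b
  go (ℕ.≤′-reflexive refl)         = ℚₚ.≤-refl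
  go (ℕ.≤′-step {n = n} m≤′n) = begin
    riemann (suc n) a b + g * (½ * ½^ n)
      ≤⟨ ℚₚ.+-monoˡ-≤ (g * (½ * ½^ n)) (riemann-step n a b) ⟩
    (riemann n a b + g * (½ * ½^ n)) + g * (½ * ½^ n)
      ≡⟨ solve 3 (λ r g h → (r :+ g :* (con ½ :* h)) :+ g :* (con ½ :* h) := r :+ g :* h) refl
           (riemann n a b) g (½^ n) ⟩
    riemann n a b + g * ½^ n
      ≤⟨ go m≤′n ⟩
    upper m a b ∎
    where g = gap a b

riemann≤upper : ∀ n a b → .{{_ : Positive a}} → .{{_ : Positive b}} →
                riemann n a b ≤ upper n a b
riemann≤upper n a b = p≤p+q (0≤p*q (gap≥0 a b) (pos⇒0≤ (½^ n) {{½^-pos n}}))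

∫dt/t : ∀ a b → .{{_ : Positive a}} → .{{_ : Positive b}} → ℝ
∫dt/t a b = record { seq = λ n → riemann n a b ; cauchy = cauchy-∫ }
  where
  cauchy-∫ : ∀ ε → .{{_ : Positive ε}} → ∃[ N ] ∀ m n → N ℕ.≤ m → N ℕ.≤ n →
             ∣ riemann m a b - riemann n a b ∣ < ε
  cauchy-∫ ε = N , λ m n N≤m N≤n → ℚₚ.≤-<-trans
    (∣u-v∣≤ (riemann-≤ a b N≤m) (ℚₚ.≤-trans (riemann≤upper m a b) (upper-≥ a b N≤m))
            (riemann-≤ a b N≤n) (ℚₚ.≤-trans (riemann≤upper n a b) (upper-≥ a b N≤n)))
    (proj₂ (archimedean (gap a b) ε))
    where
    N = proj₁ (archimedean (gap a b) ε)

-- The natural logarithm, as ∫₁^q dt/t; it is only ever applied to rational arguments.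
log : ∀ q → .{{_ : Positive q}} → ℝ
log q = ∫dt/t 1ℚ q

------------------------------------------------------------------------
-- The arithmetic functions ω, Ω and H

module _ (n : ℕ) .{{n≥2 : NonTrivial n}} where

  -- The prime factors of n, listed with multiplicity.
  primeFactors : List ℕ
  primeFactors = factors (factorise n {{ℕ.nonTrivial⇒nonZero n}})

  primeDivisors : List ℕ
  primeDivisors = deduplicate ℕₚ._≟_ primeFactors

  ω : ℕ
  ω = length primeDivisors

  primeDivisor : Fin ω → ℕ
  primeDivisor = lookup primeDivisors

  -- The exponent of the i-th prime divisor in n.
  multiplicity : Fin ω → ℕ
  multiplicity i = length (filter (primeDivisor i ℕₚ.≟_) primeFactors)

  Ω : ℕ
  Ω = ∑ℕ multiplicity

  multiplicity≢0 : ∀ i → ℕ.NonZero (multiplicity i)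
  multiplicity≢0 i = ℕ.>-nonZero (filter-some (primeDivisor i ℕₚ.≟_)
    (∈-deduplicate⁻ ℕₚ._≟_ primeFactors (∈-lookup i)))

  ω≢0 : ℕ.NonZero ω
  ω≢0 = go (factorise n {{ℕ.nonTrivial⇒nonZero n}})
    where
    go : (f : PrimeFactorisation n) → ℕ.NonZero (length (deduplicate ℕₚ._≟_ (factors f)))
    go f with factors f | PrimeFactorisation.isFactorisation f
    ... | []    | n≡1 = contradiction n≡1 (ℕ.nonTrivial⇒≢1 {n})
    ... | _ ∷ _ | _   = _

∑ℕ-nonZero : ∀ {k} → .{{ℕ.NonZero k}} → (f : Fin k → ℕ) → (∀ i → ℕ.NonZero (f i)) →
             ℕ.NonZero (∑ℕ f)
∑ℕ-nonZero {suc k} f f≢0 with f zero | f≢0 zero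
... | suc _ | _ = _

Ω≢0 : ∀ n → .{{_ : NonTrivial n}} → ℕ.NonZero (Ω n)
Ω≢0 n = ∑ℕ-nonZero {{ω≢0 n}} (multiplicity n) (multiplicity≢0 n)

infixl 7 _/Ω_

_/Ω_ : ℕ → ∀ n → .{{NonTrivial n}} → ℚ
a /Ω n = (+ a / Ω n) {{Ω≢0 n}}

/Ω-pos : ∀ a n → .{{ℕ.NonZero a}} → .{{_ : NonTrivial n}} → Positive (a /Ω n)
/Ω-pos a n = ℚₚ.normalize-pos a (Ω n) {{Ω≢0 n}}

H : ∀ n → .{{NonTrivial n}} → ℝ
H n = ⁻ ∑ℝ λ i →
  let a = multiplicity n i /Ω n
  in a · log a {{/Ω-pos (multiplicity n i) n {{multiplicity≢0 n i}}}}

------------------------------------------------------------------------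
-- The Kullback–Leibler divergence

-- A presentation n = p₁^α₁ ⋯ pᵣ^αᵣ; the divergence depends on the chosen order of the
-- prime factors, unlike ω, Ω and H.
record Factorisation (n r : ℕ) : Set where
  field
    base            : Fin r → ℕ
    exponent        : Fin r → ℕ
    base-prime      : ∀ i → Prime (base i)
    base-distinct   : Injective _≡_ _≡_ base
    exponent≢0      : ∀ i → ℕ.NonZero (exponent i)
    isFactorisation : n ≡ ∏ℕ (λ i → base i ℕ.^ exponent i)

open Factorisation public

exponent-pos : ∀ {n r} (f : Factorisation n r) i → Positive (+ exponent f i / 1)
exponent-pos f i = ℚₚ.normalize-pos (exponent f i) 1 {{_}} {{exponent≢0 f i}}

D[_∥_] : ∀ {n m r} → .{{NonTrivial n}} → .{{NonTrivial m}} →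
         Factorisation n r → Factorisation m r → ℝ
D[_∥_] {n} {m} f g = ⁻ ∑ℝ λ i →
  let a = exponent f i /Ω n
      b = exponent g i /Ω m
      instance
        a>0 : Positive a
        a>0 = /Ω-pos (exponent f i) n {{exponent≢0 f i}}
        b>0 : Positive b
        b>0 = /Ω-pos (exponent g i) m {{exponent≢0 g i}}
        a≢0 : NonZero a
        a≢0 = ℚₚ.pos⇒nonZero a
  in a · log (b ÷ a) {{ℚₚ.pos*pos⇒pos b (1/ a) {{ℚₚ.1/pos⇒pos a}}}}

{-# OPTIONS --safe #-}
-- Additivity of ∫dt/t can be read off the trapezoid sums, which differ from the right-endpoint sums by a
-- null sequence: the defect T(a,b) + T(b,c) − T(a,c) of a degenerate triangle is the signed sum of
-- the defects of its four midpoint triangles (as in Goursat's theorem), and it is cubic in the side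
-- lengths, so it decays like 4ⁿ/8ⁿ. Together with the scaling invariance of the sums this makes log
-- multiplicative.
--
-- Write aᵢ = αᵢ/Ω(n) and bᵢ = βᵢ/Ω(m). By unique factorisation Σaᵢ = Σbᵢ = 1 and
-- H(n) = −Σaᵢ log aᵢ, H(m) = −Σbᵢ log bᵢ. As log βᵢ = log bᵢ + log Ω(m), the last term vanishes from
-- Σ(bᵢ − aᵢ) log βᵢ, and what is left is −Σaᵢ log (bᵢ/aᵢ) + H(n) − H(m).
module Submission where

open import Defs
import Algebra.Properties.CommutativeMonoid.Sum as CommutativeMonoidSum
open import Data.Fin.Base using (Fin; zero; suc)
open import Data.Fin.Permutation using (Permutation; permutation; _⟨$⟩ʳ_)
open import Data.Fin.Properties using (suc-injective)
open import Data.Integer.Base as ℤ using (+_)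
import Data.Integer.Properties as ℤₚ
open import Data.List.Base
  using (List; _++_; length; filter; replicate; concat; tabulate; lookup)
open import Data.List.Membership.Propositional using (_∈_)
open import Data.List.Membership.Propositional.Properties
  using (∈-concat⁺; ∈-concat⁻; ∈-lookup; ∈-deduplicate⁺; ∈-deduplicate⁻)
open import Data.List.Properties using (filter-++; filter-all; filter-none; length-++; length-replicate)
open import Data.List.Relation.Binary.Permutation.Propositional using (_↭_; ↭-sym)
open import Data.List.Relation.Binary.Permutation.Propositional.Properties
  using (filter-↭; ↭-length; ∈-resp-↭)
open import Data.List.Relation.Unary.All as All using (All)
import Data.List.Relation.Unary.All.Properties as Allₚ
open import Data.List.Relation.Unary.AllPairs using (_∷_)
open import Data.List.Relation.Unary.Any using (here; index)
import Data.List.Relation.Unary.Any.Properties as Anyₚ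
import Data.List.Relation.Unary.Unique.DecPropositional.Properties as Uniqueₚ
open import Data.List.Relation.Unary.Unique.Propositional using (Unique)
open import Data.Nat.Base as ℕ using (ℕ; zero; suc; NonTrivial)
import Data.Nat.Coprimality as Coprimality
open import Data.Nat.ListAction using (product)
open import Data.Nat.ListAction.Properties using (product-++)
open import Data.Nat.Primality.Factorisation using (factorise; factorisationUnique)
import Data.Nat.Properties as ℕₚ
open import Data.Product.Base using (∃-syntax; _,_; proj₁; proj₂)
open import Data.Rational.Base
  using (ℚ; 0ℚ; 1ℚ; ½; _/_; _+_; _*_; _-_; -_; _÷_; 1/_; ∣_∣; _≤_; _<_;
         Positive; NonNegative; NonZero; nonNegative; toℚᵘ)
import Data.Rational.Properties as ℚₚ
open import Data.Rational.Solver using (module +-*-Solver)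
import Data.Rational.Unnormalised.Base as ℚᵘ
import Data.Rational.Unnormalised.Properties as ℚᵘₚ
open import Function.Base using (_∘_)
open import Function.Definitions using (Injective)
open import Relation.Binary.PropositionalEquality
  using (_≡_; _≢_; refl; sym; trans; cong; cong₂; subst; module ≡-Reasoning)
open import Relation.Nullary.Negation.Core using (contradiction)

open +-*-Solver using (solve; con; _:=_; _:+_; _:*_; _:-_; :-_)

-- Null sequences

-- `x ≃ y` unfolds to `Null` of the termwise difference of `seq x` and `seq y`, so equalities of
-- reals are proved below by combining null sequences.
Null : (ℕ → ℚ) → Set
Null u = ∀ ε → .{{_ : Positive ε}} → ∃[ N ] ∀ n → N ℕ.≤ n → ∣ u n ∣ < ε

null-resp : ∀ {u v} → (∀ n → u n ≡ v n) → Null u → Null v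
null-resp u≗v u→0 ε with u→0 ε
... | N , small = N , λ n N≤n → subst (λ p → ∣ p ∣ < ε) (u≗v n) (small n N≤n)

null-neg : ∀ {u} → Null u → Null (λ n → - u n)
null-neg {u} u→0 ε with u→0 ε
... | N , small = N , λ n N≤n → subst (_< ε) (sym (ℚₚ.∣-p∣≡∣p∣ (u n))) (small n N≤n)

null-+ : ∀ {u v} → Null u → Null v → Null (λ n → u n + v n)
null-+ {u} {v} u→0 v→0 ε
  with u→0 (½ * ε) {{ℚₚ.pos*pos⇒pos ½ ε}} | v→0 (½ * ε) {{ℚₚ.pos*pos⇒pos ½ ε}}
... | M , smallᵘ | N , smallᵛ = M ℕ.⊔ N , λ n M⊔N≤n → begin-strict
  ∣ u n + v n ∣      ≤⟨ ℚₚ.∣p+q∣≤∣p∣+∣q∣ (u n) (v n) ⟩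
  ∣ u n ∣ + ∣ v n ∣  <⟨ ℚₚ.+-mono-< (smallᵘ n (ℕₚ.m⊔n≤o⇒m≤o M N M⊔N≤n))
                                    (smallᵛ n (ℕₚ.m⊔n≤o⇒n≤o M N M⊔N≤n)) ⟩
  ½ * ε + ½ * ε      ≡⟨ solve 1 (λ ε → con ½ :* ε :+ con ½ :* ε := ε) refl ε ⟩
  ε                  ∎
  where open ℚₚ.≤-Reasoning

null-* : ∀ q {u} → Null u → Null (λ n → q * u n)
null-* q {u} u→0 ε = proj₁ small , λ n N≤n → begin-strict
  ∣ q * u n ∣              ≡⟨ ℚₚ.∣p*q∣≡∣p∣*∣q∣ q (u n) ⟩
  ∣ q ∣ * ∣ u n ∣          ≤⟨ ℚₚ.*-monoʳ-≤-nonNeg ∣ u n ∣ {{ℚₚ.∣-∣-nonNeg (u n)}} ∣q∣≤s ⟩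
  s * ∣ u n ∣              <⟨ ℚₚ.*-monoʳ-<-pos s (proj₂ small n N≤n) ⟩
  s * (recip s * ε)        ≡⟨ recip-cancel s ε ⟩
  ε                        ∎
  where
  open ℚₚ.≤-Reasoning
  -- The added 1 keeps `s` invertible when `q` is 0.
  s = 1ℚ + ∣ q ∣
  instance
    s>0 : Positive s
    s>0 = ℚₚ.pos+nonNeg⇒pos 1ℚ ∣ q ∣ {{ℚₚ.∣-∣-nonNeg q}}
  ∣q∣≤s : ∣ q ∣ ≤ s
  ∣q∣≤s = subst (∣ q ∣ ≤_) (ℚₚ.+-comm ∣ q ∣ 1ℚ) (p≤p+q (pos⇒0≤ 1ℚ))
  small = u→0 (recip s * ε) {{ℚₚ.pos*pos⇒pos (recip s) {{recip-pos s}} ε}}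

½^-antitone : ∀ {m n} → m ℕ.≤ n → ½^ n ≤ ½^ m
½^-antitone {m} m≤n = go (ℕₚ.≤⇒≤′ m≤n)
  where
  open ℚₚ.≤-Reasoning
  go : ∀ {n} → m ℕ.≤′ n → ½^ n ≤ ½^ m
  go (ℕ.≤′-reflexive refl)    = ℚₚ.≤-refl
  go (ℕ.≤′-step {n = n} m≤′n) = begin
    ½ * ½^ n            ≤⟨ p≤p+q (0≤p*q (pos⇒0≤ ½) (pos⇒0≤ (½^ n) {{½^-pos n}})) ⟩
    ½ * ½^ n + ½ * ½^ n ≡⟨ solve 1 (λ h → con ½ :* h :+ con ½ :* h := h) refl (½^ n) ⟩
    ½^ n                ≤⟨ go m≤′n ⟩
    ½^ m                ∎

null-geometric : ∀ {u} C → 0ℚ ≤ C → (∀ n → ∣ u n ∣ ≤ C * ½^ n) → Null u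
null-geometric {u} C 0≤C bound ε = N , λ n N≤n → begin-strict
  ∣ u n ∣    ≤⟨ bound n ⟩
  C * ½^ n   ≤⟨ ℚₚ.*-monoˡ-≤-nonNeg C {{nonNegative 0≤C}} (½^-antitone N≤n) ⟩
  C * ½^ N   <⟨ proj₂ (archimedean C ε) ⟩
  ε          ∎
  where
  open ℚₚ.≤-Reasoning
  N = proj₁ (archimedean C ε)

-- Additivity of the integral and of the logarithm

-- Over 2ⁿ pieces the left-endpoint sum exceeds the right-endpoint sum by `gap a b * ½^ n`. Adding
-- half of this gives the mean of the two sums.
trapezoid : ℕ → ∀ a b → .{{_ : Positive a}} → .{{_ : Positive b}} → ℚ
trapezoid n a b = riemann n a b + gap a b * ½^ (suc n)

-- `riemann` splits at the midpoint by definition; in the correction term, `gap-bisect` absorbs the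
-- extra factor ½.
trapezoid-bisect : ∀ n a b → .{{_ : Positive a}} → .{{_ : Positive b}} →
                   let m = midpoint a b
                       instance
                         m>0 : Positive m
                         m>0 = midpoint-pos a b
                   in trapezoid (suc n) a b ≡ trapezoid n a m + trapezoid n m b
trapezoid-bisect n a b = begin
  (r + s) + gap a b * (½ * h)
    ≡⟨ solve 4 (λ r s g h → (r :+ s) :+ g :* (con ½ :* h) := (r :+ s) :+ g :* con ½ :* h) refl
         r s (gap a b) h ⟩
  (r + s) + gap a b * ½ * h
    ≡⟨ cong (λ g → (r + s) + g * h) (gap-bisect a b) ⟨
  (r + s) + (gap a m + gap m b) * h
    ≡⟨ solve 5 (λ r s x y h → (r :+ s) :+ (x :+ y) :* h := (r :+ x :* h) :+ (s :+ y :* h)) refl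
         r s (gap a m) (gap m b) h ⟩
  trapezoid n a m + trapezoid n m b ∎
  where
  open ≡-Reasoning
  m = midpoint a b
  instance
    m>0 : Positive m
    m>0 = midpoint-pos a b
  h = ½^ (suc n)
  r = riemann n a m
  s = riemann n m b

defect : ℕ → ∀ a b c → .{{_ : Positive a}} → .{{_ : Positive b}} → .{{_ : Positive c}} → ℚ
defect n a b c = trapezoid n a b + trapezoid n b c - trapezoid n a c

-- Up to sign the Vandermonde determinant of a, b, c. Halving all differences divides it by 8.
vandermonde : ℚ → ℚ → ℚ → ℚ
vandermonde a b c = (b - a) * (b - c) * (c - a)

module _ (a b c : ℚ) .{{_ : Positive a}} .{{_ : Positive b}} .{{_ : Positive c}} where
  private
    p = midpoint a b
    q = midpoint b c
    r = midpoint a c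
    instance
      p>0 : Positive p
      p>0 = midpoint-pos a b
      q>0 : Positive q
      q>0 = midpoint-pos b c
      r>0 : Positive r
      r>0 = midpoint-pos a c

  -- The midpoints cut the degenerate triangle abc into four, as in the proof of Goursat's theorem.
  defect-bisect : ∀ n → defect (suc n) a b c ≡
                  (defect n a p r + defect n p b q) + (defect n r q c - defect n p r q)
  defect-bisect n = begin
    trapezoid (suc n) a b + trapezoid (suc n) b c - trapezoid (suc n) a c
      ≡⟨ cong₂ _-_ (cong₂ _+_ (trapezoid-bisect n a b) (trapezoid-bisect n b c))
                   (trapezoid-bisect n a c) ⟩
    (ap + pb) + (bq + qc) - (ar + rc)
      ≡⟨ solve 9 (λ ap pb bq qc ar rc pr pq rq →
           (ap :+ pb) :+ (bq :+ qc) :- (ar :+ rc)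
           := ((ap :+ pr :- ar) :+ (pb :+ bq :- pq)) :+ ((rq :+ qc :- rc) :- (pr :+ rq :- pq)))
           refl ap pb bq qc ar rc (trapezoid n p r) (trapezoid n p q) (trapezoid n r q) ⟩
    (defect n a p r + defect n p b q) + (defect n r q c - defect n p r q) ∎
    where
    open ≡-Reasoning
    ap = trapezoid n a p
    pb = trapezoid n p b
    bq = trapezoid n b q
    qc = trapezoid n q c
    ar = trapezoid n a r
    rc = trapezoid n r c

  -- For a single piece T(a,b) = ½(b - a)(1/a + 1/b), so the defect is half of (b - c)/a + (c - a)/b
  -- + (a - b)/c. Over the common denominator abc the numerator is the Vandermonde product.
  defect₀ : defect 0 a b c ≡ ½ * vandermonde a b c * (recip a * recip b * recip c)
  defect₀ = begin
    defect 0 a b c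
      ≡⟨ solve 6 (λ a b c x y z →
           ((b :- a) :* y :+ (b :- a) :* (x :- y) :* (con ½ :* con 1ℚ))
             :+ ((c :- b) :* z :+ (c :- b) :* (y :- z) :* (con ½ :* con 1ℚ))
             :- ((c :- a) :* z :+ (c :- a) :* (x :- z) :* (con ½ :* con 1ℚ))
           := con ½ :* ((b :- c) :* x :+ (c :- a) :* y :+ (a :- b) :* z)) refl a b c x y z ⟩
    ½ * ((b - c) * x + (c - a) * y + (a - b) * z)
      -- The ring solver does not know that `a * recip a` is 1. Each summand is multiplied by such
      -- units until it carries all three reciprocals; what remains is a polynomial identity.
      ≡⟨ cong (½ *_) (cong₂ _+_ (cong₂ _+_
           (cong ((b - c) *_) (insert-units x (recip-inverse b) (recip-inverse c)))
           (cong ((c - a) *_) (insert-units y (recip-inverse a) (recip-inverse c))))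
           (cong ((a - b) *_) (insert-units z (recip-inverse a) (recip-inverse b)))) ⟩
    ½ * ((b - c) * (x * (b * y) * (c * z)) + (c - a) * (y * (a * x) * (c * z))
          + (a - b) * (z * (a * x) * (b * y)))
      ≡⟨ solve 6 (λ a b c x y z →
           con ½ :* ((b :- c) :* (x :* (b :* y) :* (c :* z)) :+ (c :- a) :* (y :* (a :* x) :* (c :* z))
             :+ (a :- b) :* (z :* (a :* x) :* (b :* y)))
           := con ½ :* ((b :- a) :* (b :- c) :* (c :- a)) :* (x :* y :* z)) refl a b c x y z ⟩
    ½ * vandermonde a b c * (x * y * z) ∎
    where
    open ≡-Reasoning
    x = recip a
    y = recip b
    z = recip c
    insert-units : ∀ t {u v} → u ≡ 1ℚ → v ≡ 1ℚ → t ≡ t * u * v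
    insert-units t refl refl = sym (trans (ℚₚ.*-identityʳ (t * 1ℚ)) (ℚₚ.*-identityʳ t))

recip≤ : ∀ {u} a → .{{_ : Positive a}} → 1ℚ ≤ u * a → recip a ≤ u
recip≤ {u} a 1≤ua = begin
  recip a            ≡⟨ ℚₚ.*-identityˡ (recip a) ⟨
  1ℚ * recip a       ≤⟨ ℚₚ.*-monoʳ-≤-nonNeg (recip a) {{ℚₚ.pos⇒nonNeg (recip a) {{recip-pos a}}}} 1≤ua ⟩
  u * a * recip a    ≡⟨ ℚₚ.*-assoc u a (recip a) ⟩
  u * (a * recip a)  ≡⟨ cong (u *_) (recip-inverse a) ⟩
  u * 1ℚ             ≡⟨ ℚₚ.*-identityʳ u ⟩
  u                  ∎
  where open ℚₚ.≤-Reasoning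

*-mono-≤-nonNeg : ∀ {p q r s} → 0ℚ ≤ p → 0ℚ ≤ s → p ≤ q → r ≤ s → p * r ≤ q * s
*-mono-≤-nonNeg {p} {q} {r} {s} 0≤p 0≤s p≤q r≤s = ℚₚ.≤-trans
  (ℚₚ.*-monoˡ-≤-nonNeg p {{nonNegative 0≤p}} r≤s)
  (ℚₚ.*-monoʳ-≤-nonNeg s {{nonNegative 0≤s}} p≤q)

-- The bound 1/a ≤ u is carried as `1ℚ ≤ u * a`, which is linear in a and so passes to midpoints.
-- One `u` therefore serves for the whole subdivision.
≤-midpoint : ∀ {u} a b → 1ℚ ≤ u * a → 1ℚ ≤ u * b → 1ℚ ≤ u * midpoint a b
≤-midpoint {u} a b 1≤ua 1≤ub = begin
  ½ * (1ℚ + 1ℚ)        ≤⟨ ℚₚ.*-monoˡ-≤-nonNeg ½ (ℚₚ.+-mono-≤ 1≤ua 1≤ub) ⟩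
  ½ * (u * a + u * b)  ≡⟨ solve 3 (λ u a b → con ½ :* (u :* a :+ u :* b) := u :* (con ½ :* (a :+ b)))
                            refl u a b ⟩
  u * midpoint a b     ∎
  where open ℚₚ.≤-Reasoning

-- Induction on n. A single piece is bounded through `defect₀`, every reciprocal being at most `u`.
-- A bisection gives four triangles, each with an eighth of the Vandermonde product, so the bound is
-- multiplied by 4/8.
∣defect∣≤ : ∀ {u} n a b c → .{{_ : Positive a}} → .{{_ : Positive b}} → .{{_ : Positive c}} →
            0ℚ ≤ u → 1ℚ ≤ u * a → 1ℚ ≤ u * b → 1ℚ ≤ u * c →
            ∣ defect n a b c ∣ ≤ ∣ vandermonde a b c ∣ * (u * u * u) * ½^ n
∣defect∣≤ {u} zero a b c 0≤u 1≤ua 1≤ub 1≤uc = begin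
  ∣ defect 0 a b c ∣          ≡⟨ cong ∣_∣ (defect₀ a b c) ⟩
  ∣ ½ * V * (x * y * z) ∣     ≡⟨ ℚₚ.∣p*q∣≡∣p∣*∣q∣ (½ * V) (x * y * z) ⟩
  ∣ ½ * V ∣ * ∣ x * y * z ∣   ≡⟨ cong₂ _*_ (ℚₚ.∣p*q∣≡∣p∣*∣q∣ ½ V) (ℚₚ.0≤p⇒∣p∣≡p (0≤p*q (0≤p*q 0≤x 0≤y) 0≤z)) ⟩
  ½ * ∣ V ∣ * (x * y * z)     ≤⟨ *-mono-≤-nonNeg (0≤p*q (pos⇒0≤ ½) (ℚₚ.0≤∣p∣ V)) (0≤p*q (0≤p*q 0≤u 0≤u) 0≤u)
                                   (½p≤p (ℚₚ.0≤∣p∣ V))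
                                   (*-mono-≤-nonNeg (0≤p*q 0≤x 0≤y) 0≤u
                                     (*-mono-≤-nonNeg 0≤x 0≤u (recip≤ {u} a 1≤ua) (recip≤ {u} b 1≤ub))
                                     (recip≤ {u} c 1≤uc)) ⟩
  ∣ V ∣ * (u * u * u)         ≡⟨ ℚₚ.*-identityʳ _ ⟨
  ∣ V ∣ * (u * u * u) * 1ℚ    ∎
  where
  open ℚₚ.≤-Reasoning
  V = vandermonde a b c
  x = recip a
  y = recip b
  z = recip c
  0≤x = pos⇒0≤ x {{recip-pos a}}
  0≤y = pos⇒0≤ y {{recip-pos b}}
  0≤z = pos⇒0≤ z {{recip-pos c}}
  ½p≤p : ∀ {p} → 0ℚ ≤ p → ½ * p ≤ p
  ½p≤p {p} 0≤p = ℚₚ.≤-trans (p≤p+q (0≤p*q (pos⇒0≤ ½) 0≤p))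
    (ℚₚ.≤-reflexive (solve 1 (λ p → con ½ :* p :+ con ½ :* p := p) refl p))
∣defect∣≤ {u} (suc n) a b c 0≤u 1≤ua 1≤ub 1≤uc = begin
  ∣ defect (suc n) a b c ∣
    ≡⟨ cong ∣_∣ (defect-bisect a b c n) ⟩
  ∣ (e₁ + e₂) + (e₃ - e₄) ∣
    ≤⟨ ℚₚ.≤-trans (ℚₚ.∣p+q∣≤∣p∣+∣q∣ (e₁ + e₂) (e₃ - e₄))
         (ℚₚ.+-mono-≤ (ℚₚ.∣p+q∣≤∣p∣+∣q∣ e₁ e₂) (ℚₚ.∣p-q∣≤∣p∣+∣q∣ e₃ e₄)) ⟩
  (∣ e₁ ∣ + ∣ e₂ ∣) + (∣ e₃ ∣ + ∣ e₄ ∣)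
    ≤⟨ ℚₚ.+-mono-≤
         (ℚₚ.+-mono-≤
           (eighth a p r 1≤ua 1≤up 1≤ur (solve 3 (λ a b c →
             let p = con ½ :* (a :+ b)
                 r = con ½ :* (a :+ c)
             in (p :- a) :* (p :- r) :* (r :- a)
                := con ⅛ :* ((b :- a) :* (b :- c) :* (c :- a))) refl a b c))
           (eighth p b q 1≤up 1≤ub 1≤uq (solve 3 (λ a b c →
             let p = con ½ :* (a :+ b)
                 q = con ½ :* (b :+ c)
             in (b :- p) :* (b :- q) :* (q :- p)
                := con ⅛ :* ((b :- a) :* (b :- c) :* (c :- a))) refl a b c)))
         (ℚₚ.+-mono-≤
           (eighth r q c 1≤ur 1≤uq 1≤uc (solve 3 (λ a b c →
             let q = con ½ :* (b :+ c)
                 r = con ½ :* (a :+ c)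
             in (q :- r) :* (q :- c) :* (c :- r)
                := con ⅛ :* ((b :- a) :* (b :- c) :* (c :- a))) refl a b c))
           (eighth p r q 1≤up 1≤ur 1≤uq (solve 3 (λ a b c →
             let p = con ½ :* (a :+ b)
                 q = con ½ :* (b :+ c)
                 r = con ½ :* (a :+ c)
             in (r :- p) :* (r :- q) :* (q :- p)
                := con ⅛ :* ((b :- a) :* (b :- c) :* (c :- a))) refl a b c))) ⟩
  (e + e) + (e + e)
    ≡⟨ solve 3 (λ V k h → let e = con ⅛ :* V :* k :* h in
         (e :+ e) :+ (e :+ e) := V :* k :* (con ½ :* h)) refl ∣ V ∣ (u * u * u) (½^ n) ⟩
  ∣ V ∣ * (u * u * u) * (½ * ½^ n) ∎
  where
  open ℚₚ.≤-Reasoning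
  ⅛ = ½ * ½ * ½
  V = vandermonde a b c
  p = midpoint a b
  q = midpoint b c
  r = midpoint a c
  instance
    p>0 : Positive p
    p>0 = midpoint-pos a b
    q>0 : Positive q
    q>0 = midpoint-pos b c
    r>0 : Positive r
    r>0 = midpoint-pos a c
  1≤up = ≤-midpoint {u} a b 1≤ua 1≤ub
  1≤uq = ≤-midpoint {u} b c 1≤ub 1≤uc
  1≤ur = ≤-midpoint {u} a c 1≤ua 1≤uc
  e₁ = defect n a p r
  e₂ = defect n p b q
  e₃ = defect n r q c
  e₄ = defect n p r q
  e = ⅛ * ∣ V ∣ * (u * u * u) * ½^ n
  eighth : ∀ a b c → .{{_ : Positive a}} → .{{_ : Positive b}} → .{{_ : Positive c}} →
            1ℚ ≤ u * a → 1ℚ ≤ u * b → 1ℚ ≤ u * c → vandermonde a b c ≡ ⅛ * V →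
            ∣ defect n a b c ∣ ≤ e
  eighth a b c 1≤ua 1≤ub 1≤uc eq = subst (λ v → ∣ defect n a b c ∣ ≤ v * (u * u * u) * ½^ n)
    (trans (cong ∣_∣ eq) (ℚₚ.∣p*q∣≡∣p∣*∣q∣ ⅛ V))
    (∣defect∣≤ n a b c 0≤u 1≤ua 1≤ub 1≤uc)

-- The defect of the right-endpoint sums is that of the trapezoid sums minus a fixed combination of
-- gaps times `½^ suc n`. Both parts are bounded by a multiple of 2⁻ⁿ.
∫-additive : ∀ a b c → .{{_ : Positive a}} → .{{_ : Positive b}} → .{{_ : Positive c}} →
             ∫dt/t a b ⊕ ∫dt/t b c ≃ ∫dt/t a c
∫-additive a b c = null-geometric (C + ∣ G ∣ * ½) (0≤p+q 0≤C (0≤p*q (ℚₚ.0≤∣p∣ G) (pos⇒0≤ ½))) λ n → begin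
  ∣ riemann n a b + riemann n b c - riemann n a c ∣
    ≡⟨ cong ∣_∣ (solve 7 (λ r s t x y z h → r :+ s :- t
         := (r :+ x :* h :+ (s :+ y :* h) :- (t :+ z :* h)) :- (x :+ y :- z) :* h) refl
         (riemann n a b) (riemann n b c) (riemann n a c) (gap a b) (gap b c) (gap a c) (½^ suc n)) ⟩
  ∣ defect n a b c - G * ½^ suc n ∣
    ≤⟨ ℚₚ.∣p-q∣≤∣p∣+∣q∣ (defect n a b c) (G * ½^ suc n) ⟩
  ∣ defect n a b c ∣ + ∣ G * ½^ suc n ∣
    ≤⟨ ℚₚ.+-mono-≤ (∣defect∣≤ n a b c 0≤u 1≤ua 1≤ub 1≤uc) (ℚₚ.≤-reflexive (trans
         (ℚₚ.∣p*q∣≡∣p∣*∣q∣ G (½^ suc n))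
         (cong (∣ G ∣ *_) (ℚₚ.0≤p⇒∣p∣≡p (pos⇒0≤ (½^ suc n) {{½^-pos (suc n)}}))))) ⟩
  C * ½^ n + ∣ G ∣ * (½ * ½^ n)
    ≡⟨ solve 3 (λ C g h → C :* h :+ g :* (con ½ :* h) := (C :+ g :* con ½) :* h) refl C ∣ G ∣ (½^ n) ⟩
  (C + ∣ G ∣ * ½) * ½^ n ∎
  where
  open ℚₚ.≤-Reasoning
  0≤p+q : ∀ {p q} → 0ℚ ≤ p → 0ℚ ≤ q → 0ℚ ≤ p + q
  0≤p+q 0≤p 0≤q = ℚₚ.≤-trans 0≤p (p≤p+q 0≤q)
  x = recip a
  y = recip b
  z = recip c
  0≤x = pos⇒0≤ x {{recip-pos a}}
  0≤y = pos⇒0≤ y {{recip-pos b}}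
  0≤z = pos⇒0≤ z {{recip-pos c}}
  -- The sum of the three positive reciprocals bounds each of them, with no case distinction for a
  -- maximum.
  u = x + y + z
  G = gap a b + gap b c - gap a c
  C = ∣ vandermonde a b c ∣ * (u * u * u)
  0≤u = 0≤p+q (0≤p+q 0≤x 0≤y) 0≤z
  0≤C = 0≤p*q (ℚₚ.0≤∣p∣ (vandermonde a b c)) (0≤p*q (0≤p*q 0≤u 0≤u) 0≤u)
  1≤ : ∀ d → .{{_ : Positive d}} → ∀ {v} → 0ℚ ≤ v → 1ℚ ≤ (recip d + v) * d
  1≤ d {v} 0≤v = begin
    1ℚ                    ≡⟨ recip-inverse d ⟨
    d * recip d           ≤⟨ p≤p+q (0≤p*q 0≤v (pos⇒0≤ d)) ⟩
    d * recip d + v * d   ≡⟨ solve 3 (λ d x v → d :* x :+ v :* d := (x :+ v) :* d) refl d (recip d) v ⟩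
    (recip d + v) * d     ∎
  1≤ua = subst (λ u → 1ℚ ≤ u * a) (sym (ℚₚ.+-assoc x y z)) (1≤ a (0≤p+q 0≤y 0≤z))
  1≤ub = subst (λ u → 1ℚ ≤ u * b) (solve 3 (λ x y z → y :+ (x :+ z) := x :+ y :+ z) refl x y z)
    (1≤ b (0≤p+q 0≤x 0≤z))
  1≤uc = subst (λ u → 1ℚ ≤ u * c) (ℚₚ.+-comm z (x + y)) (1≤ c (0≤p+q 0≤x 0≤y))

-- An endpoint cannot be replaced by plain `cong`, since its positivity proof depends on it. Once
-- the equations are matched, only these proofs can differ, and they are irrelevant.
riemann-cong : ∀ n {a a′ b b′}
               .{{_ : Positive a}} .{{_ : Positive a′}} .{{_ : Positive b}} .{{_ : Positive b′}} →
               a ≡ a′ → b ≡ b′ → riemann n a b ≡ riemann n a′ b′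
riemann-cong n refl refl = refl

-- The substitution t = cs: the partition points scale with c, and each term, a length times the
-- reciprocal of the right endpoint, is homogeneous of degree 0.
riemann-scale : ∀ n c a b → .{{_ : Positive a}} → .{{_ : Positive b}} →
                .{{_ : Positive (c * a)}} → .{{_ : Positive (c * b)}} →
                riemann n (c * a) (c * b) ≡ riemann n a b
riemann-scale zero c a b = begin
  (c * b - c * a) * recip (c * b)
    ≡⟨ ℚₚ.*-identityˡ _ ⟨
  1ℚ * ((c * b - c * a) * recip (c * b))
    -- The inserted unit supplies the factor `b` that completes `c * b` against its own reciprocal,
    -- while `recip b` stays behind.
    ≡⟨ cong (_* ((c * b - c * a) * recip (c * b))) (recip-inverse b) ⟨
  b * recip b * ((c * b - c * a) * recip (c * b))
    ≡⟨ solve 5 (λ a b c x y → b :* x :* ((c :* b :- c :* a) :* y) := (b :- a) :* x :* (c :* b :* y)) refl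
         a b c (recip b) (recip (c * b)) ⟩
  (b - a) * recip b * (c * b * recip (c * b))
    ≡⟨ cong ((b - a) * recip b *_) (recip-inverse (c * b)) ⟩
  (b - a) * recip b * 1ℚ
    ≡⟨ ℚₚ.*-identityʳ _ ⟩
  (b - a) * recip b ∎
  where open ≡-Reasoning
riemann-scale (suc n) c a b = cong₂ _+_
  (trans (riemann-cong n refl midpoint-scale) (riemann-scale n c a m))
  (trans (riemann-cong n midpoint-scale refl) (riemann-scale n c m b))
  where
  m = midpoint a b
  midpoint-scale : midpoint (c * a) (c * b) ≡ c * m
  midpoint-scale = solve 3 (λ c a b → con ½ :* (c :* a :+ c :* b) := c :* (con ½ :* (a :+ b))) refl c a b
  instance
    m>0 : Positive m
    m>0 = midpoint-pos a b
    cm>0 : Positive (c * m)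
    cm>0 = subst Positive midpoint-scale (midpoint-pos (c * a) (c * b))
    m′>0 : Positive (midpoint (c * a) (c * b))
    m′>0 = midpoint-pos (c * a) (c * b)

-- The integral from 1 to pq is cut at p, and scaling by p identifies the piece from p to pq with
-- the integral from 1 to q.
log-* : ∀ p q → .{{_ : Positive p}} → .{{_ : Positive q}} → .{{_ : Positive (p * q)}} →
        log (p * q) ≃ log p ⊕ log q
log-* p q = null-resp
  (λ n → trans (solve 3 (λ x y z → :- (x :+ y :- z) := z :- (x :+ y)) refl
                  (riemann n 1ℚ p) (riemann n p (p * q)) (riemann n 1ℚ (p * q)))
               (cong (λ r → riemann n 1ℚ (p * q) - (riemann n 1ℚ p + r)) (shift n)))
  (null-neg (∫-additive 1ℚ p (p * q)))
  where
  instance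
    p1>0 : Positive (p * 1ℚ)
    p1>0 = ℚₚ.pos*pos⇒pos p 1ℚ
  shift : ∀ n → riemann n p (p * q) ≡ riemann n 1ℚ q
  shift n = trans (riemann-cong n (sym (ℚₚ.*-identityʳ p)) refl) (riemann-scale n p 1ℚ q)

-- Finite sums and averages

module ∑ℚₚ = CommutativeMonoidSum ℚₚ.+-0-commutativeMonoid
module ∑ℕₚ = CommutativeMonoidSum ℕₚ.+-0-commutativeMonoid
open ∑ℚₚ using () renaming (sum to ∑ℚ)

seq-∑ℝ : ∀ {r} (x : Fin r → ℝ) n → seq (∑ℝ x) n ≡ ∑ℚ (λ i → seq (x i) n)
seq-∑ℝ {zero}  x n = refl
seq-∑ℝ {suc r} x n = cong (λ p → seq (x zero) n + p) (seq-∑ℝ (λ i → x (suc i)) n)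

∑ℚ-distrib-- : ∀ {r} (x y : Fin r → ℚ) → ∑ℚ (λ i → x i - y i) ≡ ∑ℚ x - ∑ℚ y
∑ℚ-distrib-- {zero}  x y = refl
∑ℚ-distrib-- {suc r} x y = trans
  (cong (λ p → x zero - y zero + p) (∑ℚ-distrib-- (λ i → x (suc i)) (λ i → y (suc i))))
  (solve 4 (λ a b c d → (a :- b) :+ (c :- d) := (a :+ c) :- (b :+ d)) refl
     (x zero) (y zero) (∑ℚ (λ i → x (suc i))) (∑ℚ (λ i → y (suc i))))

null-∑ : ∀ {r} (u : Fin r → ℕ → ℚ) → (∀ i → Null (u i)) → Null (λ n → ∑ℚ (λ i → u i n))
null-∑ {zero}  u u→0 ε = 0 , λ _ _ → ℚₚ.positive⁻¹ ε
null-∑ {suc r} u u→0 = null-+ (u→0 zero) (null-∑ (λ i → u (suc i)) (λ i → u→0 (suc i)))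

ι-+ : ∀ m n → ι (m ℕ.+ n) ≡ ι m + ι n
ι-+ zero    n = sym (ℚₚ.+-identityˡ (ι n))
ι-+ (suc m) n = trans (cong (λ p → 1ℚ + p) (ι-+ m n)) (sym (ℚₚ.+-assoc 1ℚ (ι m) (ι n)))

/1≡ι : ∀ n → + n / 1 ≡ ι n
/1≡ι n = trans (ℚₚ.normalize-coprime (Coprimality.sym (Coprimality.1-coprimeTo n))) (sym (ι≡mkℚ n))

-- The fraction `+ k / d` is reduced to lowest terms, so the cancellation is carried out in the
-- unnormalised rationals, where it is a cross-multiplication.
/*ι : ∀ k d → .{{_ : ℕ.NonZero d}} → (+ k / d) * ι d ≡ ι k
/*ι k d@(suc d-1) = trans (cong ((+ k / d) *_) (sym (/1≡ι d)))
  (trans (ℚₚ.toℚᵘ-injective (begin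
    toℚᵘ ((+ k / d) * (+ d / 1))            ≈⟨ ℚₚ.toℚᵘ-homo-* (+ k / d) (+ d / 1) ⟩
    toℚᵘ (+ k / d) ℚᵘ.* toℚᵘ (+ d / 1)    ≈⟨ ℚᵘₚ.*-cong (ℚₚ.toℚᵘ-fromℚᵘ (ℚᵘ.mkℚᵘ (+ k) d-1))
                                                            (ℚₚ.toℚᵘ-fromℚᵘ (ℚᵘ.mkℚᵘ (+ d) 0)) ⟩
    (+ k ℚᵘ./ d) ℚᵘ.* (+ d ℚᵘ./ 1)            ≈⟨ ℚᵘ.*≡* (trans (ℤₚ.*-identityʳ _)
                                                   (cong (+ k ℤ.*_) (cong +_ (sym (ℕₚ.*-identityʳ d))))) ⟩
    + k ℚᵘ./ 1                                ≈⟨ ℚₚ.toℚᵘ-fromℚᵘ (ℚᵘ.mkℚᵘ (+ k) 0) ⟨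
    toℚᵘ (+ k / 1)                          ∎)) (/1≡ι k))
  where open ℚᵘₚ.≃-Reasoning

ι-pos : ∀ n → .{{_ : ℕ.NonZero n}} → Positive (ι n)
ι-pos (suc n) = ℚₚ.pos+nonNeg⇒pos 1ℚ (ι n) {{subst NonNegative (/1≡ι n) (ℚₚ.normalize-nonNeg n 1)}}

∑-ι* : ∀ {r} (k : Fin r → ℕ) p → ∑ℚ (λ i → ι (k i) * p) ≡ ι (∑ℕ k) * p
∑-ι* {zero}  k p = sym (ℚₚ.*-zeroˡ p)
∑-ι* {suc r} k p = begin
  ι (k zero) * p + ∑ℚ (λ i → ι (k (suc i)) * p)
    ≡⟨ cong (λ q → ι (k zero) * p + q) (∑-ι* (λ i → k (suc i)) p) ⟩
  ι (k zero) * p + ι K * p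
    ≡⟨ ℚₚ.*-distribʳ-+ p (ι (k zero)) (ι K) ⟨
  (ι (k zero) + ι K) * p
    ≡⟨ cong (_* p) (ι-+ (k zero) K) ⟨
  ι (k zero ℕ.+ K) * p ∎
  where
  open ≡-Reasoning
  K = ∑ℕ (λ i → k (suc i))

-- Writing p = Nq clears the denominators: the terms become kᵢq, whose total is Nq again. In the end
-- `p` is an approximation of log Ω(m), the term that has to vanish.
∑-average : ∀ {r} N → .{{_ : ℕ.NonZero N}} → (k : Fin r → ℕ) → ∑ℕ k ≡ N → ∀ p →
            ∑ℚ (λ i → (+ k i / N) * p) ≡ p
∑-average N k ∑k≡N p = begin
  ∑ℚ (λ i → (+ k i / N) * p)    ≡⟨ ∑ℚₚ.sum-cong-≗ (λ i → cong ((+ k i / N) *_) (recip-cancel (ι N) p)) ⟨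
  ∑ℚ (λ i → (+ k i / N) * (ι N * q))
    ≡⟨ ∑ℚₚ.sum-cong-≗ (λ i → trans (sym (ℚₚ.*-assoc (+ k i / N) (ι N) q)) (cong (_* q) (/*ι (k i) N))) ⟩
  ∑ℚ (λ i → ι (k i) * q)        ≡⟨ ∑-ι* k q ⟩
  ι (∑ℕ k) * q                  ≡⟨ cong (λ j → ι j * q) ∑k≡N ⟩
  ι N * q                       ≡⟨ recip-cancel (ι N) p ⟩
  p                             ∎
  where
  open ≡-Reasoning
  instance
    N>0 : Positive (ι N)
    N>0 = ι-pos N
  q = recip (ι N) * p

-- Presentations of n as a product of prime powers

-- `multiplicity n i` unfolds to a value of this function.
count : ℕ → List ℕ → ℕ
count q xs = length (filter (q ℕₚ.≟_) xs)

count-++ : ∀ q xs ys → count q (xs ++ ys) ≡ count q xs ℕ.+ count q ys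
count-++ q xs ys = trans (cong length (filter-++ (q ℕₚ.≟_) xs ys)) (length-++ (filter (q ℕₚ.≟_) xs))

count-replicate-≡ : ∀ q k → count q (replicate k q) ≡ k
count-replicate-≡ q k =
  trans (cong length (filter-all (q ℕₚ.≟_) (Allₚ.replicate⁺ k refl))) (length-replicate k)

count-∉ : ∀ {q xs} → All (q ≢_) xs → count q xs ≡ 0
count-∉ {q} q∉xs = cong length (filter-none (q ℕₚ.≟_) q∉xs)

-- A product of prime powers is written as a list with repetitions, the form in which unique
-- factorisation asserts agreement up to a permutation.
powers : ∀ {r} → (Fin r → ℕ) → (Fin r → ℕ) → List ℕ
powers b e = concat (tabulate λ i → replicate (e i) (b i))

product-powers : ∀ {r} (b e : Fin r → ℕ) → product (powers b e) ≡ ∏ℕ (λ i → b i ℕ.^ e i)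
product-powers {zero}  b e = refl
product-powers {suc r} b e =
  trans (product-++ (replicate (e zero) (b zero)) (powers (b ∘ suc) (e ∘ suc)))
        (cong₂ ℕ._*_ (product-replicate (e zero)) (product-powers (b ∘ suc) (e ∘ suc)))
  where
  product-replicate : ∀ k → product (replicate k (b zero)) ≡ b zero ℕ.^ k
  product-replicate zero    = refl
  product-replicate (suc k) = cong (b zero ℕ.*_) (product-replicate k)

All-powers : ∀ {r} {P : ℕ → Set} (b e : Fin r → ℕ) → (∀ i → P (b i)) → All P (powers b e)
All-powers b e Pb = Allₚ.concat⁺ (Allₚ.tabulate⁺ λ i → Allₚ.replicate⁺ (e i) (Pb i))

-- The list is a concatenation of constant blocks, and since `b` is injective only the i-th block
-- contributes.
count-powers : ∀ {r} (b e : Fin r → ℕ) → Injective _≡_ _≡_ b → ∀ i → count (b i) (powers b e) ≡ e i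
count-powers b e inj zero = begin
  count (b zero) (powers b e)
    ≡⟨ count-++ (b zero) (replicate (e zero) (b zero)) (powers (b ∘ suc) (e ∘ suc)) ⟩
  count (b zero) (replicate (e zero) (b zero)) ℕ.+ count (b zero) (powers (b ∘ suc) (e ∘ suc))
    ≡⟨ cong₂ ℕ._+_ (count-replicate-≡ (b zero) (e zero))
         (count-∉ (All-powers (b ∘ suc) (e ∘ suc) λ i eq → contradiction (inj eq) λ ())) ⟩
  e zero ℕ.+ 0
    ≡⟨ ℕₚ.+-identityʳ (e zero) ⟩
  e zero ∎
  where open ≡-Reasoning
count-powers b e inj (suc i) = begin
  count (b (suc i)) (powers b e)
    ≡⟨ count-++ (b (suc i)) (replicate (e zero) (b zero)) (powers (b ∘ suc) (e ∘ suc)) ⟩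
  count (b (suc i)) (replicate (e zero) (b zero)) ℕ.+ count (b (suc i)) (powers (b ∘ suc) (e ∘ suc))
    ≡⟨ cong₂ ℕ._+_ (count-∉ (Allₚ.replicate⁺ (e zero) λ eq → contradiction (inj eq) λ ()))
         (count-powers (b ∘ suc) (e ∘ suc) (suc-injective ∘ inj) i) ⟩
  e (suc i) ∎
  where open ≡-Reasoning

∈-powers⁺ : ∀ {r} (b e : Fin r → ℕ) i → ℕ.NonZero (e i) → b i ∈ powers b e
∈-powers⁺ b e i ei≢0 = ∈-concat⁺ (Anyₚ.tabulate⁺ i (∈-replicate (e i) ei≢0))
  where
  ∈-replicate : ∀ k → ℕ.NonZero k → b i ∈ replicate k (b i)
  ∈-replicate (suc k) _ = here refl

∈-powers⁻ : ∀ {r} (b e : Fin r → ℕ) {q} → q ∈ powers b e → ∃[ i ] b i ≡ q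
∈-powers⁻ b e q∈ with Anyₚ.tabulate⁻ (∈-concat⁻ (tabulate λ i → replicate (e i) (b i)) q∈)
... | i , q∈bᵢ = i , All.lookup {P = b i ≡_} (Allₚ.replicate⁺ (e i) refl) q∈bᵢ

lookup-injective : ∀ {xs : List ℕ} → Unique xs → Injective _≡_ _≡_ (lookup xs)
lookup-injective (x∉ ∷ xs!) {zero}  {zero}  eq = refl
lookup-injective (x∉ ∷ xs!) {zero}  {suc j} eq = contradiction eq (All.lookup x∉ (∈-lookup j))
lookup-injective (x∉ ∷ xs!) {suc i} {zero}  eq = contradiction (sym eq) (All.lookup x∉ (∈-lookup i))
lookup-injective (x∉ ∷ xs!) {suc i} {suc j} eq = cong suc (lookup-injective xs! eq)

-- Makes the entropy independent of the order of the primes. Reordering is exact in each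
-- approximation, which gives an equality of rationals and not only `≃`.
seq-∑-p·log : ∀ {r s} (p : Fin s → ℚ) (p>0 : ∀ j → Positive (p j))
              (q : Fin r → ℚ) (q>0 : ∀ i → Positive (q i))
              (π : Permutation r s) → (∀ i → p (π ⟨$⟩ʳ i) ≡ q i) → ∀ k →
              seq (∑ℝ (λ j → p j · log (p j) {{p>0 j}})) k ≡ ∑ℚ (λ i → q i * seq (log (q i) {{q>0 i}}) k)
seq-∑-p·log p p>0 q q>0 π p∘π≗q k = begin
  seq (∑ℝ (λ j → p j · log (p j) {{p>0 j}})) k
    ≡⟨ seq-∑ℝ (λ j → p j · log (p j) {{p>0 j}}) k ⟩
  ∑ℚ (λ j → p j * seq (log (p j) {{p>0 j}}) k)
    ≡⟨ ∑ℚₚ.sum-permute (λ j → p j * seq (log (p j) {{p>0 j}}) k) π ⟩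
  ∑ℚ (λ i → p (π ⟨$⟩ʳ i) * seq (log (p (π ⟨$⟩ʳ i)) {{p>0 (π ⟨$⟩ʳ i)}}) k)
    ≡⟨ ∑ℚₚ.sum-cong-≗ (λ i → cong₂ _*_ (p∘π≗q i)
         (riemann-cong k {{_}} {{_}} {{p>0 (π ⟨$⟩ʳ i)}} {{q>0 i}} refl (p∘π≗q i))) ⟩
  ∑ℚ (λ i → q i * seq (log (q i) {{q>0 i}}) k) ∎
  where open ≡-Reasoning

-- Multiplicities, Ω and H read off from a presentation

module _ {n r : ℕ} .{{_ : NonTrivial n}} (f : Factorisation n r) where
  private
    b = base f
    e = exponent f

  -- Unique factorisation applies because `powers b e` consists of primes and has product n.
  primeFactors↭powers : primeFactors n ↭ powers b e
  primeFactors↭powers = factorisationUnique (factorise n {{ℕ.nonTrivial⇒nonZero n}}) record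
    { factors         = powers b e
    ; isFactorisation = trans (isFactorisation f) (sym (product-powers b e))
    ; factorsPrime    = All-powers b e (base-prime f)
    }

  base∈primeDivisors : ∀ i → b i ∈ primeDivisors n
  base∈primeDivisors i = ∈-deduplicate⁺ ℕₚ._≟_
    (∈-resp-↭ (↭-sym primeFactors↭powers) (∈-powers⁺ b e i (exponent≢0 f i)))

  position : Fin r → Fin (ω n)
  position i = index (base∈primeDivisors i)

  primeDivisor-position : ∀ i → b i ≡ primeDivisor n (position i)
  primeDivisor-position i = Anyₚ.lookup-index (base∈primeDivisors i)

  base-of : ∀ j → ∃[ i ] b i ≡ primeDivisor n j
  base-of j = ∈-powers⁻ b e (∈-resp-↭ primeFactors↭powers
    (∈-deduplicate⁻ ℕₚ._≟_ (primeFactors n) (∈-lookup j)))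

  -- One inverse law holds because the deduplicated list has no repetitions, the other because the
  -- bases are distinct.
  reorder : Permutation r (ω n)
  reorder = permutation position (proj₁ ∘ base-of)
    (λ j → lookup-injective (Uniqueₚ.deduplicate-! ℕₚ._≟_ (primeFactors n))
             (trans (sym (primeDivisor-position (proj₁ (base-of j)))) (proj₂ (base-of j))))
    (λ i → base-distinct f (trans (proj₂ (base-of (position i))) (sym (primeDivisor-position i))))

  multiplicity-reorder : ∀ i → multiplicity n (reorder ⟨$⟩ʳ i) ≡ exponent f i
  multiplicity-reorder i = begin
    count (primeDivisor n (position i)) (primeFactors n)
      ≡⟨ cong (λ q → count q (primeFactors n)) (primeDivisor-position i) ⟨
    count (b i) (primeFactors n)
      ≡⟨ ↭-length (filter-↭ (b i ℕₚ.≟_) primeFactors↭powers) ⟩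
    count (b i) (powers b e)
      ≡⟨ count-powers b e (base-distinct f) i ⟩
    e i ∎
    where open ≡-Reasoning

  ∑exponent≡Ω : ∑ℕ (exponent f) ≡ Ω n
  ∑exponent≡Ω = sym (trans (∑ℕₚ.sum-permute (multiplicity n) reorder)
                           (∑ℕₚ.sum-cong-≗ multiplicity-reorder))

  proportion-pos : ∀ i → Positive (exponent f i /Ω n)
  proportion-pos i = /Ω-pos (exponent f i) n {{exponent≢0 f i}}

  proportion-average : ∀ p → ∑ℚ (λ i → (exponent f i /Ω n) * p) ≡ p
  proportion-average = ∑-average (Ω n) {{Ω≢0 n}} (exponent f) ∑exponent≡Ω

  -- Here and below, equations about concrete rationals are let-bound so that their types are inferred:
  -- unification against an ascribed type would unfold the normalised fractions.
  seq-H : ∀ k → seq (H n) k ≡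
          - 1ℚ * ∑ℚ (λ i → (exponent f i /Ω n) * seq (log (exponent f i /Ω n) {{proportion-pos i}}) k)
  seq-H k =
    let eq  = seq-∑-p·log (λ j → multiplicity n j /Ω n)
                (λ j → /Ω-pos (multiplicity n j) n {{multiplicity≢0 n j}})
                (λ i → exponent f i /Ω n) proportion-pos reorder
                (λ i → cong (_/Ω n) (multiplicity-reorder i)) k
        eq′ = cong (λ p → - 1ℚ * p) eq
    in eq′

÷-*-cancel : ∀ p q → .{{_ : NonZero q}} → (p ÷ q) * q ≡ p
÷-*-cancel p q = trans (ℚₚ.*-assoc p (1/ q) q)
  (trans (cong (p *_) (ℚₚ.*-inverseˡ q)) (ℚₚ.*-identityʳ p))

-- The variable `s` in place of the product allows the logarithms below to be taken of `b i` and
-- `β i` themselves.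
log-product-error : ∀ p q s → .{{_ : Positive p}} → .{{_ : Positive q}} → .{{_ : Positive s}} → p * q ≡ s →
                    Null (λ k → seq (log s) k - (seq (log p) k + seq (log q) k))
log-product-error p q s refl = log-* p q

-- The divergence identity for two probability distributions

module _ {r : ℕ} (a b ratio β : Fin r → ℚ) (c : ℚ) .{{c>0 : Positive c}}
         (a>0 : ∀ i → Positive (a i)) (b>0 : ∀ i → Positive (b i))
         (ratio>0 : ∀ i → Positive (ratio i)) (β>0 : ∀ i → Positive (β i))
         (ratio*a≡b : ∀ i → ratio i * a i ≡ b i) (b*c≡β : ∀ i → b i * c ≡ β i)
         (∑a≡1 : ∀ p → ∑ℚ (λ i → a i * p) ≡ p) (∑b≡1 : ∀ p → ∑ℚ (λ i → b i * p) ≡ p) where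
  private
    log-a log-b log-β log-ratio : Fin r → ℕ → ℚ
    log-a i     = seq (log (a i) {{a>0 i}})
    log-b i     = seq (log (b i) {{b>0 i}})
    log-β i     = seq (log (β i) {{β>0 i}})
    log-ratio i = seq (log (ratio i) {{ratio>0 i}})

    log-c : ℕ → ℚ
    log-c = seq (log c)

    ratio-error β-error : Fin r → ℕ → ℚ
    ratio-error i k = log-b i k - (log-ratio i k + log-a i k)
    β-error i k     = log-β i k - (log-b i k + log-c k)

    ratio-error→0 : ∀ i → Null (ratio-error i)
    ratio-error→0 i = log-product-error (ratio i) (a i) (b i) {{ratio>0 i}} {{a>0 i}} {{b>0 i}} (ratio*a≡b i)

    β-error→0 : ∀ i → Null (β-error i)
    β-error→0 i = log-product-error (b i) c (β i) {{b>0 i}} {{c>0}} {{β>0 i}} (b*c≡β i)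

    -- The weights b - a and -a of the two errors make the mixed terms a log b cancel. What remains
    -- are the sums of the divergence, of the two entropies and of the β-term.
    ∑-error : ∀ k → ∑ℚ (λ i → (b i - a i) * β-error i k - a i * ratio-error i k) ≡
              ∑ℚ (λ i → a i * log-ratio i k) + ∑ℚ (λ i → a i * log-a i k) - ∑ℚ (λ i → b i * log-b i k)
                + (∑ℚ (λ i → (b i - a i) * log-β i k) - (log-c k - log-c k))
    ∑-error k = begin
      ∑ℚ (λ i → (b i - a i) * β-error i k - a i * ratio-error i k)
        ≡⟨ ∑ℚₚ.sum-cong-≗ (λ i → solve 7 (λ a b x y z w l →
             (b :- a) :* (w :- (y :+ l)) :- a :* (y :- (x :+ z))
             := a :* x :+ a :* z :- b :* y :+ ((b :- a) :* w :- (b :* l :- a :* l))) refl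
             (a i) (b i) (log-ratio i k) (log-b i k) (log-a i k) (log-β i k) (log-c k)) ⟩
      ∑ℚ (λ i → D i + A i - B i + (R i - (S i - T i)))
        ≡⟨ ∑ℚₚ.∑-distrib-+ (λ i → D i + A i - B i) (λ i → R i - (S i - T i)) ⟩
      ∑ℚ (λ i → D i + A i - B i) + ∑ℚ (λ i → R i - (S i - T i))
        ≡⟨ cong₂ _+_ (∑ℚ-distrib-- (λ i → D i + A i) B) (∑ℚ-distrib-- R (λ i → S i - T i)) ⟩
      ∑ℚ (λ i → D i + A i) - ∑ℚ B + (∑ℚ R - ∑ℚ (λ i → S i - T i))
        ≡⟨ cong₂ (λ x y → x - ∑ℚ B + (∑ℚ R - y)) (∑ℚₚ.∑-distrib-+ D A) (∑ℚ-distrib-- S T) ⟩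
      ∑ℚ D + ∑ℚ A - ∑ℚ B + (∑ℚ R - (∑ℚ S - ∑ℚ T))
        -- Both families of weights have total 1, so log c is left once with each sign.
        ≡⟨ cong₂ (λ x y → ∑ℚ D + ∑ℚ A - ∑ℚ B + (∑ℚ R - (x - y))) (∑b≡1 (log-c k)) (∑a≡1 (log-c k)) ⟩
      ∑ℚ D + ∑ℚ A - ∑ℚ B + (∑ℚ R - (log-c k - log-c k)) ∎
      where
      open ≡-Reasoning
      D A B R S T : Fin r → ℚ
      D i = a i * log-ratio i k
      A i = a i * log-a i k
      B i = b i * log-b i k
      R i = (b i - a i) * log-β i k
      S i = b i * log-c k
      T i = a i * log-c k

  -- The formulas for `d`, `hᵃ` and `hᵇ` are exact in each approximation, so the two sides differ by
  -- exactly minus the sum in `∑-error`, a finite combination of null sequences.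
  divergence-identity : (d hᵃ hᵇ : ℝ) →
    (∀ k → seq d k ≡ - 1ℚ * ∑ℚ (λ i → a i * seq (log (ratio i) {{ratio>0 i}}) k)) →
    (∀ k → seq hᵃ k ≡ - 1ℚ * ∑ℚ (λ i → a i * seq (log (a i) {{a>0 i}}) k)) →
    (∀ k → seq hᵇ k ≡ - 1ℚ * ∑ℚ (λ i → b i * seq (log (b i) {{b>0 i}}) k)) →
    d ≃ hᵇ ⊖ hᵃ ⊕ ∑ℝ (λ i → (b i - a i) · log (β i) {{β>0 i}})
  divergence-identity d hᵃ hᵇ d≡ hᵃ≡ hᵇ≡ = null-resp (λ k → sym (error k))
    (null-neg (null-∑ (λ i k → (b i - a i) * β-error i k - a i * ratio-error i k)
      (λ i → null-+ (null-* (b i - a i) (β-error→0 i)) (null-neg (null-* (a i) (ratio-error→0 i))))))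
    where
    open ≡-Reasoning
    error : ∀ k →
            seq d k - (seq hᵇ k + - 1ℚ * seq hᵃ k + seq (∑ℝ (λ i → (b i - a i) · log (β i) {{β>0 i}})) k) ≡
            - ∑ℚ (λ i → (b i - a i) * β-error i k - a i * ratio-error i k)
    error k = begin
      seq d k - (seq hᵇ k + - 1ℚ * seq hᵃ k + seq (∑ℝ (λ i → (b i - a i) · log (β i) {{β>0 i}})) k)
        ≡⟨ cong₂ (λ x y → x - (seq hᵇ k + - 1ℚ * seq hᵃ k + y)) (d≡ k)
             (seq-∑ℝ (λ i → (b i - a i) · log (β i) {{β>0 i}}) k) ⟩
      - 1ℚ * ∑D - (seq hᵇ k + - 1ℚ * seq hᵃ k + ∑R)
        ≡⟨ cong₂ (λ x y → - 1ℚ * ∑D - (x + - 1ℚ * y + ∑R)) (hᵇ≡ k) (hᵃ≡ k) ⟩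
      - 1ℚ * ∑D - (- 1ℚ * ∑B + - 1ℚ * (- 1ℚ * ∑A) + ∑R)
        ≡⟨ solve 5 (λ D B A R L →
             con (- 1ℚ) :* D :- (con (- 1ℚ) :* B :+ con (- 1ℚ) :* (con (- 1ℚ) :* A) :+ R)
             := :- (D :+ A :- B :+ (R :- (L :- L)))) refl ∑D ∑B ∑A ∑R (log-c k) ⟩
      - (∑D + ∑A - ∑B + (∑R - (log-c k - log-c k)))
        ≡⟨ cong (λ x → - x) (∑-error k) ⟨
      - ∑ℚ (λ i → (b i - a i) * β-error i k - a i * ratio-error i k) ∎
      where
      ∑D = ∑ℚ (λ i → a i * log-ratio i k)
      ∑A = ∑ℚ (λ i → a i * log-a i k)
      ∑B = ∑ℚ (λ i → b i * log-b i k)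
      ∑R = ∑ℚ (λ i → (b i - a i) * log-β i k)

-- Application to the proportions of two presentations

module _ {n m r : ℕ} .{{_ : NonTrivial n}} .{{_ : NonTrivial m}}
         (f : Factorisation n r) (g : Factorisation m r) where

  proportion≢0 : ∀ i → NonZero (exponent f i /Ω n)
  proportion≢0 i = ℚₚ.pos⇒nonZero (exponent f i /Ω n) {{proportion-pos f i}}

  ratio-pos : ∀ i → Positive (((exponent g i /Ω m) ÷ (exponent f i /Ω n)) {{proportion≢0 i}})
  ratio-pos i = ℚₚ.pos*pos⇒pos (exponent g i /Ω m) {{proportion-pos g i}}
    ((1/ (exponent f i /Ω n)) {{proportion≢0 i}})
    {{ℚₚ.1/pos⇒pos (exponent f i /Ω n) {{proportion-pos f i}}}}

  seq-D : ∀ k → seq D[ f ∥ g ] k ≡ - 1ℚ * ∑ℚ (λ i → (exponent f i /Ω n) *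
            seq (log (((exponent g i /Ω m) ÷ (exponent f i /Ω n)) {{proportion≢0 i}}) {{ratio-pos i}}) k)
  seq-D k =
    -- The summand is copied from the definition of `D[_∥_]`.
    let eq  = seq-∑ℝ (λ i →
                let a = exponent f i /Ω n
                    b = exponent g i /Ω m
                    instance
                      a>0 : Positive a
                      a>0 = /Ω-pos (exponent f i) n {{exponent≢0 f i}}
                      b>0 : Positive b
                      b>0 = /Ω-pos (exponent g i) m {{exponent≢0 g i}}
                      a≢0 : NonZero a
                      a≢0 = ℚₚ.pos⇒nonZero a
                in a · log (b ÷ a) {{ℚₚ.pos*pos⇒pos b (1/ a) {{ℚₚ.1/pos⇒pos a}}}}) k
        eq′ = cong (λ p → - 1ℚ * p) eq
    in eq′

proposition2p1 : ∀ (m n r : ℕ) → .{{_ : NonTrivial m}} → .{{_ : NonTrivial n}} →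
    ω m ≡ r → ω n ≡ r →
    (f : Factorisation n r) (g : Factorisation m r) →
    D[ f ∥ g ] ≃ H m ⊖ H n ⊕ ∑ℝ (λ i →
    (exponent g i /Ω m - exponent f i /Ω n) · log (+ exponent g i / 1) {{exponent-pos g i}})
-- The instances are explicit because an unsolved one would make Agda compare real numbers by unfolding.
proposition2p1 m n r {{m≥2}} {{n≥2}} _ _ f g =
  let identity = divergence-identity
        (λ i → _/Ω_ (exponent f i) n {{n≥2}}) (λ i → _/Ω_ (exponent g i) m {{m≥2}})
        (λ i → (_/Ω_ (exponent g i) m {{m≥2}} ÷ _/Ω_ (exponent f i) n {{n≥2}})
               {{proportion≢0 {{n≥2}} {{m≥2}} f g i}})
        -- The constant `c` is Ω(m), since βᵢ is βᵢ/Ω(m) times Ω(m).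
        (λ i → + exponent g i / 1) (ι (Ω m {{m≥2}})) {{ι-pos (Ω m {{m≥2}}) {{Ω≢0 m {{m≥2}}}}}}
        (proportion-pos {{n≥2}} f) (proportion-pos {{m≥2}} g)
        (ratio-pos {{n≥2}} {{m≥2}} f g) (exponent-pos g)
        (λ i → ÷-*-cancel (_/Ω_ (exponent g i) m {{m≥2}}) (_/Ω_ (exponent f i) n {{n≥2}})
               {{proportion≢0 {{n≥2}} {{m≥2}} f g i}})
        (λ i → trans (/*ι (exponent g i) (Ω m {{m≥2}}) {{Ω≢0 m {{m≥2}}}}) (sym (/1≡ι (exponent g i))))
        (proportion-average {{n≥2}} f) (proportion-average {{m≥2}} g)
        (D[_∥_] {{n≥2}} {{m≥2}} f g) (H n {{n≥2}}) (H m {{m≥2}})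
        (seq-D {{n≥2}} {{m≥2}} f g) (seq-H {{n≥2}} f) (seq-H {{m≥2}} g)
  in identity
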